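{- Consider the following nondeterministic program on states $(w,x,y,z)\in\mathbb{Z}^4$. Initially $(w,x,y,z)$ is an arbitrary element of $\mathbb{Z}^4$ supplied by the user. While $w>0$ and $x>0$ and $y>0$ and $z>0$, the user chooses a value $\mathrm{control}\in\{1,2,3\}$ and the following is executed: \begin{itemize} \item if $\mathrm{control}=1$: $x$ is replaced by a value chosen by the user from $\{x+1,x+2,\ldots\}$, $w$ is replaced by $w-1$, and $y,z$ are unchanged; \item if $\mathrm{control}=2$: $y$ is replaced by a value chosen by the user from $\{y+1,y+2,\ldots\}$, $x$ is replaced by $x-1$, and $w,z$ are unchanged; \item if $\mathrm{control}=3$: $z$ is replaced by a value chosen by the user from $\{z+1,z+2,\ldots\}$, $y$ is replaced by $y-1$, and $w,x$ are unchanged. \end{itemize} Then every computation of this program is finite.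
   Context: A program is a tuple $(S,I,R)$ where $S$ is a set of states, $I\subseteq S$ is the set of possible initial states, and $R\subseteq S\times S$ is the set of pairs $(s,t)$ such that $s$ satisfies the condition of the while loop and some choice of instruction (and of user inputs) takes $s$ to $t$ in one iteration of the loop body. A computation is a finite or infinite sequence of states $s_1,s_2,\ldots$ with $s_1\in I$, with $R(s_i,s_{i+1})$ for all consecutive terms, and such that if the sequence is finite with last state $s$ then there is no $t$ with $R(s,t)$. Here $S=I=\mathbb{Z}^4$. -}

module Defs where

open import Data.Integer.Base using (ℤ; 0ℤ; 1ℤ; _-_; _<_; _>_)
open import Data.Maybe.Base using (Maybe; just; nothing)
open import Data.Nat.Base using (ℕ; zero; suc)
open import Data.Product.Base using (∃; _×_; _,_)
open import Level using (0ℓ)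
open import Relation.Binary.Core using (Rel)
open import Relation.Binary.PropositionalEquality.Core using (_≡_)
open import Relation.Nullary.Negation.Core using (¬_)
open import Relation.Unary using (Pred; U)

record Program : Set₁ where
  field
    S : Set
    I : Pred S 0ℓ
    R : Rel S 0ℓ

-- A finite or infinite sequence s₁, s₂, … is a function on ℕ in which
-- at i = just s means that sᵢ₊₁ exists and equals s (indices start at 0), and
-- at i = nothing means that the sequence has at most i terms.
record Sequence (A : Set) : Set where
  field
    at     : ℕ → Maybe A
    closed : ∀ i → at i ≡ nothing → at (suc i) ≡ nothing

Finite : {A : Set} → Sequence A → Set
Finite σ = ∃ λ i → Sequence.at σ i ≡ nothing

record IsComputation (P : Program) (σ : Sequence (Program.S P)) : Set where
  open Program P
  open Sequence σ
  field
    initial : ∃ λ s → at zero ≡ just s × I s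
    step    : ∀ i {s t} → at i ≡ just s → at (suc i) ≡ just t → R s t
    final   : ∀ i {s} → at i ≡ just s → at (suc i) ≡ nothing → ¬ (∃ λ t → R s t)

State : Set
State = ℤ × ℤ × ℤ × ℤ

Guard : Pred State 0ℓ
Guard (w , x , y , z) = w > 0ℤ × x > 0ℤ × y > 0ℤ × z > 0ℤ

data Control : Set where
  one two three : Control

-- The primed variable is the value chosen by the user.
data Body : Control → Rel State 0ℓ where
  body₁ : ∀ {w x y z x′} → x < x′ → Body one   (w , x , y , z) (w - 1ℤ , x′ , y , z)
  body₂ : ∀ {w x y z y′} → y < y′ → Body two   (w , x , y , z) (w , x - 1ℤ , y′ , z)
  body₃ : ∀ {w x y z z′} → z < z′ → Body three (w , x , y , z) (w , x , y - 1ℤ , z′)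

program : Program
program = record
  { S = State
  ; I = U
  ; R = λ s t → Guard s × ∃ λ control → Body control s t
  }

{-# OPTIONS --safe #-}

-- Each iteration strictly decreases (w , x , y) in the lexicographic order,
-- whatever value the user picks for the variable that grows: the guard makes
-- the decremented variable positive, and every variable listed before it is
-- unchanged.  Since this order is well-founded on ℕ³, no computation is infinite.

module Submission where

open import Defs

open import Data.Integer.Base using (ℤ; 0ℤ; 1ℤ; +_; +<+; _-_; _>_; ∣_∣)
open import Data.Maybe.Base using (just; nothing)
open import Data.Nat.Base using (ℕ; suc; _<_)
open import Data.Nat.Induction using (<-wellFounded)
open import Data.Nat.Properties using (n<1+n)
open import Data.Product.Base using (_×_; _,_)
open import Data.Product.Relation.Binary.Lex.Strict using (×-Lex; ×-wellFounded)
open import Data.Sum.Base using (inj₁; inj₂)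
open import Function.Base using (flip; _on_)
open import Induction.WellFounded using (Acc; acc; WellFounded; module Subrelation)
open import Level using (0ℓ)
open import Relation.Binary.Construct.On using () renaming (wellFounded to on-wellFounded)
open import Relation.Binary.Core using (Rel)
open import Relation.Binary.PropositionalEquality.Core using (_≡_; refl)

module _ (P : Program) where
  open Program P

  -- Follow `σ` from its first state by recursion on accessibility: each further term is an
  -- `R`-successor, hence has a smaller accessibility proof, so the walk must stop, and it can only
  -- stop where `at` is `nothing`.
  wellFounded⇒computationsFinite : WellFounded (flip R) →
    (σ : Sequence S) → IsComputation P σ → Finite σ
  wellFounded⇒computationsFinite wf σ comp =
    let s , at₀≡s , _ = initial in from 0 at₀≡s (wf s)
    where
    open Sequence σ
    open IsComputation comp

    from : ∀ i {s} → at i ≡ just s → Acc (flip R) s → Finite σ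
    from i atᵢ≡s (acc rs) with at (suc i) in eq
    ... | nothing = suc i , eq
    ... | just t  = from (suc i) eq (rs (step i atᵢ≡s eq))

_≺_ : Rel (ℕ × ℕ × ℕ) 0ℓ
_≺_ = ×-Lex _≡_ _<_ (×-Lex _≡_ _<_ _<_)

≺-wellFounded : WellFounded _≺_
≺-wellFounded = ×-wellFounded <-wellFounded (×-wellFounded <-wellFounded <-wellFounded)

-- Taking absolute values is harmless: only positive variables are decremented.
rank : State → ℕ × ℕ × ℕ
rank (w , x , y , z) = ∣ w ∣ , ∣ x ∣ , ∣ y ∣

i>0⇒∣i-1∣<∣i∣ : ∀ {i} → i > 0ℤ → ∣ i - 1ℤ ∣ < ∣ i ∣
-- Here `+ suc n - 1ℤ` computes to `+ n`. A negative `i` needs no clause, as no constructor of the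
-- integer order fits.
i>0⇒∣i-1∣<∣i∣ {+ suc n} _        = n<1+n n
i>0⇒∣i-1∣<∣i∣ {+ 0}     (+<+ ())

rank-decreases : ∀ {s t} → Program.R program s t → rank t ≺ rank s
rank-decreases ((w>0 , _)         , one   , body₁ _) = inj₁ (i>0⇒∣i-1∣<∣i∣ w>0)
rank-decreases ((_ , x>0 , _)     , two   , body₂ _) = inj₂ (refl , inj₁ (i>0⇒∣i-1∣<∣i∣ x>0))
rank-decreases ((_ , _ , y>0 , _) , three , body₃ _) = inj₂ (refl , inj₂ (refl , i>0⇒∣i-1∣<∣i∣ y>0))

program-wellFounded : WellFounded (flip (Program.R program))
program-wellFounded =
  Subrelation.wellFounded {_<₂_ = _≺_ on rank} rank-decreases (on-wellFounded rank ≺-wellFounded)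

theorem4p4 : (σ : Sequence State) → IsComputation program σ → Finite σ
theorem4p4 = wellFounded⇒computationsFinite program program-wellFounded
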